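{- For all $n\geq2$: $\mathrm{LLPO}\leq_{\mathrm{sW}}\mathrm{RET}_n\equiv_{\mathrm{sW}}\mathrm{AUC}_n\leq_{\mathrm{sW}}\mathrm C_n$, and $\mathrm{RET}_n\leq_{\mathrm{sW}}\mathrm{RET}_{\mathbb N}\equiv_{\mathrm W}\mathrm{LPO}$.
   Context: A represented space is a set $X$ with a partial surjective map $\delta_X:\subseteq\mathbb N^{\mathbb N}\to X$. A problem is a partial multi-valued function $f:\subseteq X\rightrightarrows Y$ between represented spaces that has a realizer; a realizer of $f$ is a function $F:\subseteq\mathbb N^{\mathbb N}\to\mathbb N^{\mathbb N}$ with $\delta_YF(p)\in f\delta_X(p)$ for all $p\in\mathrm{dom}(f\delta_X)$. For $p,q\in\mathbb N^{\mathbb N}$, $\langle p,q\rangle(2n)=p(n)$, $\langle p,q\rangle(2n+1)=q(n)$. For problems $f,g$: $f\leq_{\mathrm W}g$ if there are computable $H,K:\subseteq\mathbb N^{\mathbb N}\to\mathbb N^{\mathbb N}$ such that $H\langle\mathrm{id},GK\rangle$ is a realizer of $f$ whenever $G$ is a realizer of $g$; $f\leq_{\mathrm{sW}}g$ is defined likewise with $HGK$ instead of $H\langle\mathrm{id},GK\rangle$. $\equiv_{\mathrm W},\equiv_{\mathrm{sW}}$ are the induced equivalences. $p-1\in\mathbb N^{\mathbb N}\cup\mathbb N^*$ denotes the finite or infinite concatenation of $p(0)-1,p(1)-1,\dots$, where $0-1$ is the empty word. For a represented space $X$, the completion $\overline X:=X\cup\{\bot\}$ ($\bot\notin X$) is represented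 by the total map $\delta_{\overline X}$ with $\delta_{\overline X}(p)=\delta_X(p-1)$ if $p-1\in\mathrm{dom}(\delta_X)$ and $\delta_{\overline X}(p)=\bot$ otherwise. Spaces $X\subseteq\mathbb N$ are represented by $p\mapsto p(0)$ (for $p(0)\in X$), $\mathbb N^{\mathbb N}$ by the identity. A number $n$ is identified with $\{0,\dots,n-1\}$. For a represented space $X$ the retraction problem is $\mathrm{RET}_X:\overline X\rightrightarrows X$, $x\mapsto\{y\in X:x\in X\Rightarrow x=y\}$. For $X\subseteq\mathbb N$: - $\mathrm C_X:\subseteq\mathbb N^{\mathbb N}\rightrightarrows X$, $p\mapsto X\setminus\mathrm{range}(p-1)$, with domain $\{p:|X\setminus\mathrm{range}(p-1)|\geq1\}$; $\mathrm{LLPO}:=\mathrm C_2$. - $\mathrm{AUC}_X:\subseteq\mathbb N^{\mathbb N}\rightrightarrows X$, $p\mapsto X\setminus\mathrm{range}(p-1)$, with domain $\{p:|X\setminus\mathrm{range}(p-1)|=1\text{ or }\mathrm{range}(p-1)=\emptyset\}$. - $\mathrm{LPO}:\mathbb N^{\mathbb N}\to\{0,1\}$, $\mathrm{LPO}(p)=1:\iff p=000\dots$. -}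

module Defs where

open import Axiom.ExcludedMiddle using (ExcludedMiddle)
open import Data.Empty using (⊥-elim)
open import Data.Fin using (Fin)
open import Data.List as List using (List; []; _∷_; concatMap; applyUpTo; head; drop)
open import Data.Maybe using (Maybe; just; nothing)
import Data.Maybe.Relation.Binary.Pointwise as Maybe
open import Data.Nat using (ℕ; zero; suc; _+_; _*_; _≤_; _<_; z≤n; s≤s)
open import Data.Nat.Induction using (<-rec)
open import Data.Nat.Properties using (≤-antisym; ≤-total; ≮⇒≥; +-suc)
open import Data.Product using (Σ; ∃; ∃-syntax; ∃₂; ∃!; _×_; _,_; proj₁; proj₂)
open import Data.Sum using (_⊎_; inj₁; inj₂)
open import Data.Vec as Vec using (Vec; []; _∷_)
open import Function using (_∘_; const; _⇔_; mk⇔; Equivalence)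
open import Level using (0ℓ)
open import Relation.Binary using (Setoid)
import Relation.Binary.Construct.On as On
open import Relation.Binary.PropositionalEquality
  using (_≡_; _≗_; refl; sym; trans; cong; cong₂; subst; _→-setoid_; setoid)
open import Relation.Nullary using (¬_; Dec; yes; no)
open import Relation.Unary using (Pred; _∈_; _∉_; _∖_; Empty)

-- A multi-valued function f is given by its graph { (x , y) | y ∈ f(x) };
-- its domain is { x | f(x) ≠ ∅ }.
record _⇉_ (A B : Setoid 0ℓ 0ℓ) : Set₁ where
  private
    module A = Setoid A
    module B = Setoid B
  field
    graph : A.Carrier → B.Carrier → Set
    resp  : ∀ {a a′ b b′} → a A.≈ a′ → b B.≈ b′ → graph a b → graph a′ b′

  dom : Pred A.Carrier 0ℓ
  dom a = ∃ (graph a)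

open _⇉_ public

record _⇀_ (A B : Setoid 0ℓ 0ℓ) : Set₁ where
  field
    multi      : A ⇉ B
    functional : ∀ {a b b′} → graph multi a b → graph multi a b′ → Setoid._≈_ B b b′

open _⇀_ public

infix 4 _⟨_⟩↦_
_⟨_⟩↦_ : ∀ {A B} → A ⇀ B → Setoid.Carrier A → Setoid.Carrier B → Set
F ⟨ a ⟩↦ b = graph (multi F) a b

domain : ∀ {A B} → A ⇀ B → Pred (Setoid.Carrier A) 0ℓ
domain F = dom (multi F)

infixr 9 _∙_
_∙_ : ∀ {A B C} → B ⇀ C → A ⇀ B → A ⇀ C
_∙_ {A} {B} {C} G F = record
  { multi = record
    { graph = λ a c → ∃ λ b → F ⟨ a ⟩↦ b × G ⟨ b ⟩↦ c
    ; resp  = λ a≈ c≈ (b , f , g) →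
        b , resp (multi F) a≈ (Setoid.refl B) f , resp (multi G) (Setoid.refl B) c≈ g
    }
  ; functional = λ (b , f , g) (b′ , f′ , g′) →
      functional G (resp (multi G) (functional F f f′) (Setoid.refl C) g) g′
  }

Baire : Set
Baire = ℕ → ℕ

𝔹 : Setoid 0ℓ 0ℓ
𝔹 = ℕ →-setoid ℕ

⟨_,_⟩ : Baire → Baire → Baire
⟨ p , q ⟩ zero    = p zero
⟨ p , q ⟩ (suc n) = ⟨ q , p ∘ suc ⟩ n

⟨,⟩-even : ∀ p q n → ⟨ p , q ⟩ (n + n) ≡ p n
⟨,⟩-even p q zero = refl
⟨,⟩-even p q (suc n) rewrite +-suc n n = ⟨,⟩-even (p ∘ suc) (q ∘ suc) n

⟨,⟩-odd : ∀ p q n → ⟨ p , q ⟩ (suc (n + n)) ≡ q n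
⟨,⟩-odd p q n = ⟨,⟩-even q (p ∘ suc) n

⟨,⟩-cong : ∀ {p p′ q q′} → p ≗ p′ → q ≗ q′ → ⟨ p , q ⟩ ≗ ⟨ p′ , q′ ⟩
⟨,⟩-cong p≗ q≗ zero    = p≗ zero
⟨,⟩-cong p≗ q≗ (suc n) = ⟨,⟩-cong q≗ (p≗ ∘ suc) n

⟨id,_⟩ : 𝔹 ⇀ 𝔹 → 𝔹 ⇀ 𝔹
⟨id, F ⟩ = record
  { multi = record
    { graph = λ p r → ∃ λ q → F ⟨ p ⟩↦ q × r ≗ ⟨ p , q ⟩
    ; resp  = λ p≗ r≗ (q , f , e) →
        q , resp (multi F) p≗ (λ _ → refl) f ,
        λ n → trans (sym (r≗ n)) (trans (e n) (⟨,⟩-cong p≗ (λ _ → refl) n))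
    }
  ; functional = λ (q , f , e) (q′ , f′ , e′) n →
      trans (e n) (trans (⟨,⟩-cong (λ _ → refl) (functional F f f′) n) (sym (e′ n)))
  }

-- Codes for the partial recursive functions relative to an oracle: a type-2
-- machine computing F amounts to a single code e such that, for every p in
-- the domain of F, n ↦ F(p)(n) is computed by e with oracle p.

data Code : ℕ → Set where
  zero   : ∀ {k} → Code k
  succ   : Code 1
  proj   : ∀ {k} → Fin k → Code k
  oracle : Code 1
  comp   : ∀ {k m} → Code m → Vec (Code k) m → Code k
  prec   : ∀ {k} → Code k → Code (2 + k) → Code (1 + k)
  min    : ∀ {k} → Code (1 + k) → Code k

-- p ⊢ e · xs ⇓ y : with oracle p, the code e halts on input xs with output y.
infix 4 _⊢_·_⇓_
data _⊢_·_⇓_ (p : Baire) : ∀ {k} → Code k → Vec ℕ k → ℕ → Set where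
  zero      : ∀ {k} {xs : Vec ℕ k} → p ⊢ zero · xs ⇓ 0
  succ      : ∀ {x} → p ⊢ succ · x ∷ [] ⇓ suc x
  proj      : ∀ {k} {xs : Vec ℕ k} (i : Fin k) → p ⊢ proj i · xs ⇓ Vec.lookup xs i
  oracle    : ∀ {x} → p ⊢ oracle · x ∷ [] ⇓ p x
  comp      : ∀ {k m} {f : Code m} {gs : Vec (Code k) m} {xs : Vec ℕ k} (ys : Vec ℕ m) {z} →
              (∀ i → p ⊢ Vec.lookup gs i · xs ⇓ Vec.lookup ys i) →
              p ⊢ f · ys ⇓ z → p ⊢ comp f gs · xs ⇓ z
  prec-zero : ∀ {k} {f : Code k} {g : Code (2 + k)} {xs : Vec ℕ k} {y} →
              p ⊢ f · xs ⇓ y → p ⊢ prec f g · 0 ∷ xs ⇓ y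
  prec-suc  : ∀ {k} {f : Code k} {g : Code (2 + k)} {xs : Vec ℕ k} {n y z} →
              p ⊢ prec f g · n ∷ xs ⇓ y → p ⊢ g · n ∷ y ∷ xs ⇓ z →
              p ⊢ prec f g · suc n ∷ xs ⇓ z
  min       : ∀ {k} {f : Code (1 + k)} {xs : Vec ℕ k} {n} →
              (∀ i → i < n → ∃ λ v → p ⊢ f · i ∷ xs ⇓ suc v) →
              p ⊢ f · n ∷ xs ⇓ 0 → p ⊢ min f · xs ⇓ n

-- As usual, a computable partial function may be undefined at further
-- arguments at which the algorithm happens to produce a total output.
Computable : 𝔹 ⇀ 𝔹 → Set
Computable F = ∃ λ (e : Code 1) →
  ∀ p q → F ⟨ p ⟩↦ q → ∀ n → p ⊢ e · n ∷ [] ⇓ q n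

record RepresentedSpace : Set₁ where
  field
    space      : Setoid 0ℓ 0ℓ
    δ          : 𝔹 ⇀ space
    surjective : ∀ x → ∃ λ p → δ ⟨ p ⟩↦ x

open RepresentedSpace public

Realizer : (X Y : RepresentedSpace) → space X ⇉ space Y → 𝔹 ⇀ 𝔹 → Set
Realizer X Y f F = ∀ p x → δ X ⟨ p ⟩↦ x → x ∈ dom f →
  ∃₂ λ q y → F ⟨ p ⟩↦ q × δ Y ⟨ q ⟩↦ y × graph f x y

record Problem : Set₁ where
  field
    source target : RepresentedSpace
    function      : space source ⇉ space target

  _Realizes : 𝔹 ⇀ 𝔹 → Set
  _Realizes = Realizer source target function

  field
    realizable : ∃ _Realizes

open Problem public using (realizable)

_realizes_ : 𝔹 ⇀ 𝔹 → Problem → Set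
F realizes f = Problem._Realizes f F

infix 4 _≤W_ _≤sW_ _≡W_ _≡sW_

_≤W_ : Problem → Problem → Set₁
f ≤W g = ∃₂ λ H K → Computable H × Computable K ×
  (∀ G → G realizes g → (H ∙ ⟨id, G ∙ K ⟩) realizes f)

_≤sW_ : Problem → Problem → Set₁
f ≤sW g = ∃₂ λ H K → Computable H × Computable K ×
  (∀ G → G realizes g → (H ∙ G ∙ K) realizes f)

_≡W_ : Problem → Problem → Set₁
f ≡W g = f ≤W g × g ≤W f

_≡sW_ : Problem → Problem → Set₁
f ≡sW g = f ≤sW g × g ≤sW f

letter : ℕ → List ℕ
letter zero    = []
letter (suc m) = m ∷ []

prefix : Baire → ℕ → List ℕ
prefix p k = concatMap letter (applyUpTo p k)

-- The finite or infinite word p − 1, as the graph of a function from an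
-- initial segment of ℕ (or from ℕ): (p ∸1) i m says that its i-th letter is m.
_∸1 : Baire → ℕ → ℕ → Set
(p ∸1) i m = ∃ λ k → head (drop i (prefix p k)) ≡ just m

range : (ℕ → ℕ → Set) → Pred ℕ 0ℓ
range w m = ∃ λ i → w i m

-- w is infinite, and equal to q ∈ ℕ^ℕ.
_≐_ : (ℕ → ℕ → Set) → Baire → Set
w ≐ q = ∀ i → w i (q i)

prefix-cong : ∀ {p p′} → p ≗ p′ → ∀ k → prefix p k ≡ prefix p′ k
prefix-cong p≗ zero    = refl
prefix-cong p≗ (suc k) = cong₂ List._++_ (cong letter (p≗ 0)) (prefix-cong (p≗ ∘ suc) k)

∸1-resp : ∀ {p p′} → p ≗ p′ → ∀ i {m} → (p ∸1) i m → (p′ ∸1) i m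
∸1-resp p≗ i (k , e) =
  k , trans (cong (head ∘ drop i) (sym (prefix-cong p≗ k))) e

prefix-mono : ∀ p i {m k k′} → k ≤ k′ →
  head (drop i (prefix p k)) ≡ just m → head (drop i (prefix p k′)) ≡ just m
prefix-mono p zero    z≤n ()
prefix-mono p (suc i) z≤n ()
prefix-mono p i (s≤s k≤) e with p 0
prefix-mono p i       (s≤s k≤) e | zero  = prefix-mono (p ∘ suc) i k≤ e
prefix-mono p zero    (s≤s k≤) e | suc _ = e
prefix-mono p (suc i) (s≤s k≤) e | suc _ = prefix-mono (p ∘ suc) i k≤ e

just-inj : ∀ {m n : ℕ} {x : Maybe ℕ} → x ≡ just m → x ≡ just n → m ≡ n
just-inj refl refl = refl

∸1-functional : ∀ p i {m m′} → (p ∸1) i m → (p ∸1) i m′ → m ≡ m′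
∸1-functional p i (k , e) (k′ , e′) with ≤-total k k′
... | inj₁ k≤ = just-inj (prefix-mono p i k≤ e) e′
... | inj₂ k≥ = just-inj e (prefix-mono p i k≥ e′)

suc-∸1 : ∀ q → ((suc ∘ q) ∸1) ≐ q
suc-∸1 q i = suc i , go q i
  where
  go : ∀ q i → head (drop i (prefix (suc ∘ q) (suc i))) ≡ just (q i)
  go q zero    = refl
  go q (suc i) = go (q ∘ suc) i

0-∸1 : ∀ {q} → ¬ ((const 0 ∸1) ≐ q)
0-∸1 w with w 0
... | k , e = go k e
  where
  go : ∀ k {m} → ¬ (head (prefix (const 0) k) ≡ just m)
  go (suc k) e = go k e

baire : RepresentedSpace
baire = record
  { space      = 𝔹
  ; δ          = record
    { multi      = record
      { graph = _≗_
      ; resp  = λ p≗ q≗ e n → trans (sym (p≗ n)) (trans (e n) (q≗ n)) }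
    ; functional = λ e e′ n → trans (sym (e n)) (e′ n) }
  ; surjective = λ p → p , λ _ → refl
  }

subspace : Pred ℕ 0ℓ → RepresentedSpace
subspace X = record
  { space      = On.setoid {B = ∃ X} (setoid ℕ) proj₁
  ; δ          = record
    { multi      = record
      { graph = λ p x → p 0 ≡ proj₁ x
      ; resp  = λ p≗ x≡ e → trans (sym (p≗ 0)) (trans e x≡) }
    ; functional = λ e e′ → trans (sym e) e′ }
  ; surjective = λ x → const (proj₁ x) , refl
  }

-- Here nothing plays the role of ⊥.
completion : RepresentedSpace → RepresentedSpace
completion X = record
  { space      = Maybe.setoid (space X)
  ; δ          = record
    { multi      = record { graph = name ; resp = λ {p} {p′} → name-resp {p} {p′} }
    ; functional = λ {p} → name-functional {p} }
  ; surjective = λ where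
      (just x) → let (q , d) = surjective X x in suc ∘ q , q , suc-∸1 q , d
      nothing  → const 0 , λ (q , w , _) → 0-∸1 {q} w
  }
  where
  module X = Setoid (space X)
  open Setoid (Maybe.setoid (space X)) using (_≈_)

  name : Baire → Maybe X.Carrier → Set
  name p (just x) = ∃ λ q → (p ∸1) ≐ q × δ X ⟨ q ⟩↦ x
  name p nothing  = ¬ (∃ λ q → (p ∸1) ≐ q × q ∈ domain (δ X))

  name-resp : ∀ {p p′ x x′} → p ≗ p′ → x ≈ x′ → name p x → name p′ x′
  name-resp p≗ (Maybe.just x≈) (q , w , d) =
    q , (λ i → ∸1-resp p≗ i (w i)) , resp (multi (δ X)) (λ _ → refl) x≈ d
  name-resp p≗ Maybe.nothing ¬w (q , w , d) =
    ¬w (q , (λ i → ∸1-resp (sym ∘ p≗) i (w i)) , d)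

  name-functional : ∀ {p x x′} → name p x → name p x′ → x ≈ x′
  name-functional {p} {just x} {just x′} (q , w , d) (q′ , w′ , d′) = Maybe.just
    (functional (δ X)
      (resp (multi (δ X)) (λ i → ∸1-functional p i (w i) (w′ i)) X.refl d) d′)
  name-functional {x = just x}  {nothing} (q , w , d) ¬w = ⊥-elim (¬w (q , w , x , d))
  name-functional {x = nothing} {just x}  ¬w (q , w , d) = ⊥-elim (¬w (q , w , x , d))
  name-functional {x = nothing} {nothing} _ _ = Maybe.nothing

retraction : (X : RepresentedSpace) → space (completion X) ⇉ space X
retraction X = record
  { graph = λ x y → ∀ x′ → x X̄.≈ just x′ → x′ X.≈ y
  ; resp  = λ x≈ y≈ r x′ e → X.trans (r x′ (X̄.trans x≈ e)) y≈
  }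
  where
  module X = Setoid (space X)
  module X̄ = Setoid (space (completion X))

range-resp : ∀ {p p′} → p ≗ p′ → ∀ m → m ∈ range (p ∸1) → m ∈ range (p′ ∸1)
range-resp p≗ m (i , w) = i , ∸1-resp p≗ i w

∖-resp : ∀ (X : Pred ℕ 0ℓ) {p p′} → p ≗ p′ →
  ∀ m → m ∈ X ∖ range (p ∸1) → m ∈ X ∖ range (p′ ∸1)
∖-resp X p≗ m (m∈ , m∉) = m∈ , m∉ ∘ range-resp (sym ∘ p≗) m

-- The domain { p : |X ∖ range (p − 1)| ≥ 1 } is the set of all p with at
-- least one possible value.
choice : (X : Pred ℕ 0ℓ) → 𝔹 ⇉ space (subspace X)
choice X = record
  { graph = λ p y → proj₁ y ∈ X ∖ range (p ∸1)
  ; resp  = λ { {b = y} {b′ = y′} p≗ refl (_ , y∉) →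
      ∖-resp X p≗ (proj₁ y′) (proj₂ y′ , y∉) }
  }

-- The disjunct ∃! says that X ∖ range (p − 1) has exactly one element. If X is
-- nonempty, every p in this set has a value, so that it is the domain (in the
-- sense of dom) of allOrUnique X.
allOrUniqueDomain : Pred ℕ 0ℓ → Pred Baire 0ℓ
allOrUniqueDomain X p = ∃! _≡_ (X ∖ range (p ∸1)) ⊎ Empty (range (p ∸1))

allOrUnique : (X : Pred ℕ 0ℓ) → 𝔹 ⇉ space (subspace X)
allOrUnique X = record
  { graph = λ p y → p ∈ allOrUniqueDomain X × graph (choice X) p y
  ; resp  = λ {_} {_} {y} {y′} p≗ y≡ (d , c) →
      domain-resp p≗ d , resp (choice X) {b = y} {b′ = y′} p≗ y≡ c
  }
  where
  domain-resp : ∀ {p p′} → p ≗ p′ → p ∈ allOrUniqueDomain X → p′ ∈ allOrUniqueDomain X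
  domain-resp p≗ (inj₁ (m , a , u)) =
    inj₁ (m , ∖-resp X p≗ m a , λ {k} a′ → u (∖-resp X (sym ∘ p≗) k a′))
  domain-resp p≗ (inj₂ e) = inj₂ λ m m∈ → e m (range-resp (sym ∘ p≗) m m∈)

isZero : 𝔹 ⇉ space (subspace (_< 2))
isZero = record
  { graph = λ p y → proj₁ y ≡ 1 ⇔ p ≗ const 0
  ; resp  = λ { p≗ refl e → mk⇔
      (λ y≡1 n → trans (sym (p≗ n)) (Equivalence.to e y≡1 n))
      (λ z → Equivalence.from e (λ n → trans (p≗ n) (z n))) }
  }

-- Excluded middle is needed already for these multi-valued functions to be
-- problems, i.e. to have realizers.

module Classical (em : ExcludedMiddle 0ℓ) where

  Least : Pred ℕ 0ℓ → Pred ℕ 0ℓ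
  Least P m = P m × (∀ k → P k → m ≤ k)

  least : ∀ (P : Pred ℕ 0ℓ) n → P n → ∃ (Least P)
  least P = <-rec _ step
    where
    step : ∀ n → (∀ {k} → k < n → P k → ∃ (Least P)) → P n → ∃ (Least P)
    step n rec Pn with em {∃ λ k → k < n × P k}
    ... | yes (k , k<n , Pk) = rec k<n Pk
    ... | no none = n , Pn , λ k Pk → ≮⇒≥ λ k<n → none (k , k<n , Pk)

  -- The realizer picks the least possible value.
  problem : ∀ {X} (A : Pred ℕ 0ℓ) → space X ⇉ space (subspace A) → Problem
  problem {X} A f = record
    { source = X ; target = subspace A ; function = f
    ; realizable = F , λ p x d (y , v) →
        let (m , (m∈ , v′) , l) = least (Value x) (proj₁ y) (proj₂ y , v)
        in const m , (m , m∈) , (x , d , m , ((m∈ , v′) , l) , λ _ → refl) , refl , v′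
    }
    where
    module X = Setoid (space X)

    Value : X.Carrier → Pred ℕ 0ℓ
    Value x m = ∃ λ (m∈ : m ∈ A) → graph f x (m , m∈)

    Value-resp : ∀ {x x′ m} → x X.≈ x′ → Value x m → Value x′ m
    Value-resp {m = m} x≈ (m∈ , v) =
      m∈ , resp f {b = m , m∈} {b′ = m , m∈} x≈ refl v

    F : 𝔹 ⇀ 𝔹
    F = record
      { multi = record
        { graph = λ p q → ∃ λ x → δ X ⟨ p ⟩↦ x × ∃ λ m → Least (Value x) m × q ≗ const m
        ; resp  = λ p≗ q≗ (x , d , m , l , e) →
            x , resp (multi (δ X)) p≗ X.refl d , m , l , λ n → trans (sym (q≗ n)) (e n)
        }
      ; functional = λ { (x , d , m , (v , l) , e) (x′ , d′ , m′ , (v′ , l′) , e′) n →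
          let x≈ = functional (δ X) d d′
          in trans (e n) (trans
               (≤-antisym (l m′ (Value-resp (X.sym x≈) v′)) (l′ m (Value-resp x≈ v)))
               (sym (e′ n))) }
      }

  RET C AUC : Pred ℕ 0ℓ → Problem
  RET X = problem {completion (subspace X)} X (retraction (subspace X))
  C   X = problem {baire} X (choice X)
  AUC X = problem {baire} X (allOrUnique X)

  LLPO LPO : Problem
  LLPO = C (_< 2)
  LPO  = problem {baire} (_< 2) isZero

{-# OPTIONS --safe #-}
-- The reductions to RET turn an instance into a sequence that is 0 until the answer m
-- is found and m + 1 from then on, i.e. a name of m or of ⊥. For C₂ and AUC_n, m is the only
-- number below n that has not been enumerated; for LPO, m is the position of the first
-- nonzero entry, and evaluating the instance at whatever number RET returns decides whether
-- it is zero. Conversely, RET_n reduces to AUC_n by enumerating, once the first letter has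
-- appeared, all other numbers below n, and RET_ℕ reduces to LPO by an unbounded search for the
-- first letter, which stops at once if LPO says that there is none.
module Submission where

open import Defs
open import Axiom.ExcludedMiddle using (ExcludedMiddle)
open import Data.Fin using (Fin; zero; suc)
open import Data.List using (head; drop)
open import Data.Maybe using (just; nothing)
import Data.Maybe.Relation.Binary.Pointwise as Maybe
open import Data.Nat using (ℕ; zero; suc; pred; _+_; _∸_; _⊔_; _≤_; _<_; z≤n; s≤s; ≢-nonZero)
open import Data.Nat.Properties
open import Data.Product using (∃; ∃₂; _×_; _,_; proj₁; proj₂)
open import Data.Sum using (_⊎_; inj₁; inj₂)
open import Data.Vec as Vec using (Vec; []; _∷_; lookup; tabulate)
open import Data.Vec.Properties using (lookup-map; tabulate∘lookup; tabulate-cong; tabulate-∘)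
open import Function using (_∘_; id; case_of_; const; _⇔_; mk⇔; Equivalence)
open import Level using (0ℓ)
open import Relation.Binary using (tri<; tri≈; tri>)
open import Relation.Binary.PropositionalEquality hiding (resp)
open import Relation.Nullary using (yes; no; contradiction)
open import Relation.Nullary.Decidable using (decidable-stable)
open import Relation.Unary using (Pred; U; _∈_; _∉_; Empty)

-- Functions computed by codes

⇓-resp : ∀ {p p′ k} {e : Code k} {xs y} → p ≗ p′ → p ⊢ e · xs ⇓ y → p′ ⊢ e · xs ⇓ y
⇓-resp p≗ zero            = zero
⇓-resp p≗ succ            = succ
⇓-resp p≗ (proj i)        = proj i
⇓-resp p≗ (oracle {x})    = subst (_ ⊢ oracle · x ∷ [] ⇓_) (sym (p≗ x)) oracle
⇓-resp p≗ (comp ys gs f)  = comp ys (λ i → ⇓-resp p≗ (gs i)) (⇓-resp p≗ f)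
⇓-resp p≗ (prec-zero f)   = prec-zero (⇓-resp p≗ f)
⇓-resp p≗ (prec-suc r g)  = prec-suc (⇓-resp p≗ r) (⇓-resp p≗ g)
⇓-resp p≗ (min below f)   =
  min (λ i i<n → proj₁ (below i i<n) , ⇓-resp p≗ (proj₂ (below i i<n))) (⇓-resp p≗ f)

lookup-injective : ∀ {n} {xs ys : Vec ℕ n} → lookup xs ≗ lookup ys → xs ≡ ys
lookup-injective {xs = xs} {ys} eq =
  trans (sym (tabulate∘lookup xs)) (trans (tabulate-cong eq) (tabulate∘lookup ys))

-- Determinism makes `machine e` single-valued. For `min`, the smaller of two distinct outputs would
-- give `f` both the value 0 and a successor value.
⇓-functional : ∀ {p k} {e : Code k} {xs y z} → p ⊢ e · xs ⇓ y → p ⊢ e · xs ⇓ z → y ≡ z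
⇓-functional zero           zero            = refl
⇓-functional succ           succ            = refl
⇓-functional (proj i)       (proj .i)       = refl
⇓-functional oracle         oracle          = refl
⇓-functional (comp ys gs f) (comp zs gs′ f′)
  with refl ← lookup-injective {xs = ys} {zs} (λ i → ⇓-functional (gs i) (gs′ i))
  = ⇓-functional f f′
⇓-functional (prec-zero f)  (prec-zero f′)  = ⇓-functional f f′
⇓-functional (prec-suc r g) (prec-suc r′ g′)
  with refl ← ⇓-functional r r′ = ⇓-functional g g′
⇓-functional (min {n = n} below f) (min {n = n′} below′ f′) with <-cmp n n′
... | tri≈ _ n≡n′ _ = n≡n′
... | tri< n<n′ _ _ with () ← ⇓-functional f (proj₂ (below′ n n<n′))
... | tri> _ _ n′<n with () ← ⇓-functional f′ (proj₂ (below n′ n′<n))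

machine : Code 1 → 𝔹 ⇀ 𝔹
machine e = record
  { multi      = record
    { graph = λ p q → ∀ n → p ⊢ e · n ∷ [] ⇓ q n
    ; resp  = λ p≗ q≗ d n → subst (_ ⊢ e · n ∷ [] ⇓_) (q≗ n) (⇓-resp p≗ (d n)) }
  ; functional = λ d d′ n → ⇓-functional (d n) (d′ n)
  }

machine-computable : ∀ e → Computable (machine e)
machine-computable e = e , λ p q d → d

-- Total oracle computations: codes paired with their values

record Total (k : ℕ) : Set where
  field
    code  : Code k
    val   : Baire → Vec ℕ k → ℕ
    sound : ∀ p xs → p ⊢ code · xs ⇓ val p xs

open Total

computes : (P : Total 1) → ∀ p → machine (code P) ⟨ p ⟩↦ (λ n → val P p (n ∷ []))
computes P p n = sound P p (n ∷ [])

-- Fixes the form in which values unfold: `val (missingᵗ n) p (k ∷ [])` is `missing n p k` by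
-- definition, so that `computes` applies without conversion.
withValue : ∀ {k} (P : Total k) (f : Baire → Vec ℕ k → ℕ) →
  (∀ p xs → val P p xs ≡ f p xs) → Total k
withValue P f eq = record
  { code = code P ; val = f
  ; sound = λ p xs → subst (p ⊢ code P · xs ⇓_) (eq p xs) (sound P p xs) }

apply : ∀ {k m} → Total m → Vec (Total k) m → Total k
apply f gs = record
  { code  = comp (code f) (Vec.map code gs)
  ; val   = λ p xs → val f p (Vec.map (λ g → val g p xs) gs)
  ; sound = λ p xs → comp _
      (λ i → subst₂ (p ⊢_· xs ⇓_) (sym (lookup-map i code gs)) (sym (lookup-map i _ gs))
               (sound (lookup gs i) p xs))
      (sound f p _)
  }

var : ∀ {k} → Fin k → Total k
var i = record { code = proj i ; val = λ _ xs → lookup xs i ; sound = λ _ _ → proj i }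

successor : Total 1
successor = record
  { code = succ ; val = λ { _ (x ∷ []) → suc x } ; sound = λ { _ (x ∷ []) → succ } }

ask : ∀ {k} → Total k → Total k
ask e = apply (record
  { code = oracle ; val = λ { p (x ∷ []) → p x } ; sound = λ { _ (x ∷ []) → oracle } })
  (e ∷ [])

sucᵗ : ∀ {k} → Total k → Total k
sucᵗ e = apply successor (e ∷ [])

numeral : ∀ {k} → ℕ → Code k
numeral zero    = zero
numeral (suc n) = comp succ (numeral n ∷ [])

numeral-sound : ∀ {p k} {xs : Vec ℕ k} n → p ⊢ numeral n · xs ⇓ n
numeral-sound zero    = zero
numeral-sound (suc n) = comp (n ∷ []) (λ { zero → numeral-sound n }) succ

num : ∀ {k} → ℕ → Total k
num n = record { code = numeral n ; val = λ _ _ → n ; sound = λ _ _ → numeral-sound n }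

recurse : ∀ {k} → Total k → Total (2 + k) → Total (1 + k)
recurse {k} f g = record { code = prec (code f) (code g) ; val = v ; sound = s }
  where
  v : Baire → Vec ℕ (1 + k) → ℕ
  v p (zero ∷ xs)  = val f p xs
  v p (suc n ∷ xs) = val g p (n ∷ v p (n ∷ xs) ∷ xs)
  s : ∀ p xs → p ⊢ prec (code f) (code g) · xs ⇓ v p xs
  s p (zero ∷ xs)  = prec-zero (sound f p xs)
  s p (suc n ∷ xs) = prec-suc (s p (n ∷ xs)) (sound g p _)

ifZero : ℕ → ℕ → ℕ → ℕ
ifZero zero    a b = a
ifZero (suc _) a b = b

ifZeroᵗ : ∀ {k} → Total k → Total k → Total k → Total k
ifZeroᵗ c a b = apply
  -- The step sees the predecessor, the recursive value, `a` and `b`; variable 3 is `b`.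
  (withValue (recurse (var zero) (var (suc (suc (suc zero)))))
    (λ { _ (c ∷ a ∷ b ∷ []) → ifZero c a b })
    (λ { _ (zero ∷ _ ∷ _ ∷ []) → refl ; _ (suc _ ∷ _ ∷ _ ∷ []) → refl }))
  (c ∷ a ∷ b ∷ [])

predecessor : Total 1
predecessor = withValue (recurse (num 0) (var zero)) (λ { _ (n ∷ []) → pred n })
  (λ { _ (zero ∷ []) → refl ; _ (suc _ ∷ []) → refl })

predᵗ : ∀ {k} → Total k → Total k
predᵗ e = apply predecessor (e ∷ [])

infixl 6 _+ᵗ_ _∸ᵗ_
_+ᵗ_ _∸ᵗ_ : ∀ {k} → Total k → Total k → Total k
a +ᵗ b = apply
  (withValue (recurse (var zero) (sucᵗ (var (suc zero)))) (λ { _ (m ∷ n ∷ []) → m + n }) eq)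
  (a ∷ b ∷ [])
  where
  eq : ∀ p xs → _
  eq p (zero ∷ n ∷ [])  = refl
  eq p (suc m ∷ n ∷ []) = cong suc (eq p (m ∷ n ∷ []))
a ∸ᵗ b = apply
  -- The recursion runs on the subtrahend, which therefore comes first.
  (withValue (recurse (var zero) (predᵗ (var (suc zero)))) (λ { _ (n ∷ m ∷ []) → m ∸ n }) eq)
  (b ∷ a ∷ [])
  where
  eq : ∀ p xs → _
  eq p (zero ∷ m ∷ [])  = refl
  eq p (suc n ∷ m ∷ []) = trans (cong pred (eq p (n ∷ m ∷ []))) (pred[m∸n]≡m∸[1+n] m n)

-- Bounded and unbounded search

-- As for the codes min, the value 0 stands for truth: search g n is i + 1 for the least
-- i < n with g i ≡ 0, and 0 if there is none.
search : (ℕ → ℕ) → ℕ → ℕ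
search g zero    = 0
search g (suc n) = ifZero (search g n) (ifZero (g n) (suc n) 0) (search g n)

searchᵗ : ∀ {k} → Total (suc k) → Total k → Total k
searchᵗ {k} g b = withValue
  (apply (withValue (recurse (num 0) step) below below-correct) (b ∷ tabulate var))
  (λ p xs → search (λ i → val g p (i ∷ xs)) (val b p xs))
  (λ p xs → cong (λ ys → below p (val b p xs ∷ ys)) (vars-val id xs (λ _ → refl)))
  where
  below : Baire → Vec ℕ (suc k) → ℕ
  below p (n ∷ xs) = search (λ i → val g p (i ∷ xs)) n

  step : Total (2 + k)
  step = ifZeroᵗ (var (suc zero))
    (ifZeroᵗ (apply g (var zero ∷ tabulate (var ∘ λ j → suc (suc j)))) (sucᵗ (var zero)) (num 0))
    (var (suc zero))

  -- Parameters are handed on as variables: `ρ` is the identity outside the recursion, and inside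
  -- its step a shift past the index and the result so far.
  vars-val : ∀ {m} {p} {ys : Vec ℕ m} (ρ : Fin k → Fin m) xs → (∀ i → lookup ys (ρ i) ≡ lookup xs i) →
    Vec.map (λ e → val e p ys) (tabulate (var ∘ ρ)) ≡ xs
  vars-val ρ xs eq = trans (sym (tabulate-∘ _ (var ∘ ρ)))
    (trans (tabulate-cong eq) (tabulate∘lookup xs))

  below-correct : ∀ p xs → val (recurse (num 0) step) p xs ≡ below p xs
  below-correct p (zero ∷ xs)  = refl
  below-correct p (suc n ∷ xs) = cong₂
    (λ s ys → ifZero s (ifZero (val g p (n ∷ ys)) (suc n) 0) s)
    (below-correct p (n ∷ xs)) (vars-val (λ j → suc (suc j)) xs (λ _ → refl))

LeastZero : (ℕ → ℕ) → ℕ → Set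
LeastZero g i = g i ≡ 0 × (∀ j → j < i → g j ≢ 0)

search-none : ∀ g n → search g n ≡ 0 → ∀ i → i < n → g i ≢ 0
search-none g (suc n) eq i i<1+n gi≡0 with search g n in eqₙ
search-none g (suc n) () i i<1+n gi≡0 | suc _
... | zero with m≤n⇒m<n∨m≡n (≤-pred i<1+n)
...   | inj₁ i<n = search-none g n eqₙ i i<n gi≡0
...   | inj₂ refl rewrite gi≡0 with () ← eq

search-some : ∀ g n {i} → search g n ≡ suc i → i < n × LeastZero g i
search-some g (suc n) eq with search g n in eqₙ
... | suc _ with refl ← eq = let (i<n , l) = search-some g n eqₙ in m<n⇒m<1+n i<n , l
search-some g (suc n) eq | zero with g n in eqg
search-some g (suc n) refl | zero | zero = n<1+n n , eqg , search-none g n eqₙ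

leastZero-unique : ∀ g {i j} → LeastZero g i → LeastZero g j → i ≡ j
leastZero-unique g {i} {j} (gi , i-least) (gj , j-least) with <-cmp i j
... | tri< i<j _ _ = contradiction gi (j-least i i<j)
... | tri≈ _ i≡j _ = i≡j
... | tri> _ _ j<i = contradiction gj (i-least j j<i)

search-least : ∀ g {n i} → LeastZero g i → i < n → search g n ≡ suc i
search-least g {n} {i} l i<n with search g n in eq
... | zero  = contradiction (proj₁ l) (search-none g n eq i i<n)
... | suc j = cong suc (leastZero-unique g (proj₂ (search-some g n eq)) l)

minimise : ∀ {k p} {xs : Vec ℕ k} {n} (f : Total (suc k)) →
  LeastZero (λ i → val f p (i ∷ xs)) n → p ⊢ min (code f) · xs ⇓ n
minimise {p = p} {xs} f (fn , below) = min (λ i i<n → nonzero i (below i i<n))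
  (subst (p ⊢ code f · _ ⇓_) fn (sound f p _))
  where
  nonzero : ∀ i → val f p (i ∷ xs) ≢ 0 → ∃ λ v → p ⊢ code f · i ∷ xs ⇓ suc v
  nonzero i fi≢0 with val f p (i ∷ xs) | sound f p (i ∷ xs)
  ... | zero  | _ = contradiction refl fi≢0
  ... | suc v | d = v , d

-- The distance |a - b|, an equality test in which 0 stands for truth.
difference : ℕ → ℕ → ℕ
difference a b = (a ∸ b) + (b ∸ a)

differenceᵗ : ∀ {k} → Total k → Total k → Total k
differenceᵗ a b = (a ∸ᵗ b) +ᵗ (b ∸ᵗ a)

difference-refl : ∀ a → difference a a ≡ 0
difference-refl a rewrite n∸n≡0 a = refl

difference≡0 : ∀ a b → difference a b ≡ 0 → a ≡ b
difference≡0 a b eq = ≤-antisym (m∸n≡0⇒m≤n (m+n≡0⇒m≡0 (a ∸ b) eq))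
  (m∸n≡0⇒m≤n (m+n≡0⇒n≡0 (a ∸ b) eq))

-- `suc x ∸ n` is 0 exactly when x < n. Larger numbers become 0, so that an answer below n is given
-- in every case.
clamp : ℕ → ℕ → ℕ
clamp n x = ifZero (suc x ∸ n) x 0

clampᵗ : ∀ {k} → ℕ → Total k → Total k
clampᵗ n e = ifZeroᵗ (sucᵗ e ∸ᵗ num n) e (num 0)

clamp-< : ∀ {n} x → 0 < n → clamp n x < n
clamp-< {n} x 0<n with suc x ∸ n in eq
... | zero  = m∸n≡0⇒m≤n eq
... | suc _ = 0<n

clamp-fix : ∀ {n x} → x < n → clamp n x ≡ x
clamp-fix x<n rewrite m≤n⇒m∸n≡0 x<n = refl

-- Letters of p − 1

letter-skip : ∀ p i {m} → p 0 ≡ 0 → ((p ∘ suc) ∸1) i m → (p ∸1) i m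
letter-skip p i {m} p0 (k , e) = suc k , eq
  where
  eq : head (drop i (prefix p (suc k))) ≡ just m
  eq rewrite p0 = e

letter-here : ∀ p {m} → p 0 ≡ suc m → (p ∸1) 0 m
letter-here p {m} p0 = 1 , eq
  where
  eq : head (prefix p 1) ≡ just m
  eq rewrite p0 = refl

letter-there : ∀ p i {a m} → p 0 ≡ suc a → ((p ∘ suc) ∸1) i m → (p ∸1) (suc i) m
letter-there p i {m = m} p0 (k , e) = suc k , eq
  where
  eq : head (drop (suc i) (prefix p (suc k))) ≡ just m
  eq rewrite p0 = e

∈range : ∀ p k {m} → p k ≡ suc m → m ∈ range (p ∸1)
∈range p zero    e = 0 , letter-here p e
∈range p (suc k) e with p 0 in p0 | ∈range (p ∘ suc) k e
... | zero  | i , w = i , letter-skip p i p0 w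
... | suc _ | i , w = suc i , letter-there p i p0 w

range∋ : ∀ p {m} → m ∈ range (p ∸1) → ∃ λ k → p k ≡ suc m
range∋ p (i , k , e) = go p i k e
  where
  go : ∀ p i k {m} → head (drop i (prefix p k)) ≡ just m → ∃ λ k → p k ≡ suc m
  go p zero    zero ()
  go p (suc i) zero ()
  go p i (suc k) e with p 0 in p0
  go p i       (suc k) e    | zero  = let (l , eq) = go (p ∘ suc) i k e in suc l , eq
  go p zero    (suc k) refl | suc _ = 0 , p0
  go p (suc i) (suc k) e    | suc _ = let (l , eq) = go (p ∘ suc) i k e in suc l , eq

FirstLetter : Baire → ℕ → ℕ → Set
FirstLetter p k m = p k ≡ suc m × (∀ j → j < k → p j ≡ 0)

firstLetter : ∀ p {m} → (p ∸1) 0 m → ∃ λ k → FirstLetter p k m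
firstLetter p (l , e) = go p l e
  where
  go : ∀ p l {m} → head (prefix p l) ≡ just m → ∃ λ k → FirstLetter p k m
  go p (suc l) e with p 0 in p0
  go p (suc l) e | zero =
    let (k , pk , below) = go (p ∘ suc) l e
    in suc k , pk , λ { zero _ → p0 ; (suc j) (s≤s j<k) → below j j<k }
  go p (suc l) refl | suc _ = 0 , p0 , λ _ ()

-- `1 ∸ p i` is 0 exactly when `p i` is nonzero, so a search for a zero of it finds the first
-- letter.
firstLetter-least : ∀ p {k m} → FirstLetter p k m → LeastZero (λ i → 1 ∸ p i) k
firstLetter-least p {m = m} (pk , below) =
  subst (λ x → 1 ∸ x ≡ 0) (sym pk) (0∸n≡0 m) ,
  λ j j<k eq → contradiction (trans (sym (cong (1 ∸_) (below j j<k))) eq) λ ()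

-- Induction on `b`, removing the first entry: 0 adds no letter and `suc m` adds the letter `m`. At
-- `b` = 0 every entry is `suc m`.
eventually-constant : ∀ s m b → (∀ k → s k ≡ 0 ⊎ s k ≡ suc m) →
  (∀ k → b ≤ k → s k ≡ suc m) → (s ∸1) ≐ const m
eventually-constant s m zero _ tail i =
  ∸1-resp (λ k → sym (tail k z≤n)) i (suc-∸1 (const m) i)
eventually-constant s m (suc b) cases tail i
  with cases 0 | eventually-constant (s ∘ suc) m b (cases ∘ suc) (λ k b≤k → tail (suc k) (s≤s b≤k))
... | inj₁ s0 | w = letter-skip s i s0 (w i)
eventually-constant s m (suc b) cases tail zero    | inj₂ s0 | w = letter-here s s0
eventually-constant s m (suc b) cases tail (suc i) | inj₂ s0 | w = letter-there s i s0 (w i)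

firstLetter-unique : ∀ p {k a m} → (p ∸1) 0 m → FirstLetter p k a → m ≡ a
firstLetter-unique p w first
  with l , first′ ← firstLetter p w
  with refl ← leastZero-unique (λ i → 1 ∸ p i) (firstLetter-least p first′) (firstLetter-least p first)
  = suc-injective (trans (sym (proj₁ first′)) (proj₁ first))

-- Naming the only number not enumerated

-- Searches for a such that every other number below n occurs among the letters read so far.
missing : ℕ → Baire → ℕ → ℕ
missing n p k = search (λ a → search (λ j →
  ifZero (difference j a) 1 (search (λ i → difference (p i) (suc j)) k)) n) n

missingᵗ : ℕ → Total 1
-- The variables are j, a, k, and i, j, a, k in the body of the innermost search.
missingᵗ n = searchᵗ (searchᵗ (ifZeroᵗ (differenceᵗ (var zero) (var (suc zero))) (num 1)
  (searchᵗ (differenceᵗ (ask (var zero)) (sucᵗ (var (suc zero)))) (var (suc (suc zero)))))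
  (num n)) (num n)

-- A maximum over finitely many positions, taken by induction on `n`.
enumeration-bound : ∀ (p : Baire) y n → (∀ j → j < n → j ≢ y → ∃ λ i → p i ≡ suc j) →
  ∃ λ b → ∀ j → j < n → j ≢ y → ∃ λ i → i < b × p i ≡ suc j
enumeration-bound p y zero    _ = 0 , λ _ ()
enumeration-bound p y (suc n) found
  with n ≟ y | enumeration-bound p y n (λ j j<n → found j (m<n⇒m<1+n j<n))
... | yes refl | b , earlier = b , λ j j<1+n j≢n → earlier j (≤∧≢⇒< (≤-pred j<1+n) j≢n) j≢n
... | no n≢y | b , earlier = b ⊔ suc i , later
  where
  i = proj₁ (found n (n<1+n n) n≢y)
  later : ∀ j → j < suc n → j ≢ y → ∃ λ l → l < b ⊔ suc i × p l ≡ suc j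
  later j j<1+n j≢y with m≤n⇒m<n∨m≡n (≤-pred j<1+n)
  ... | inj₂ refl = i , m≤n⊔m b (suc i) , proj₂ (found n (n<1+n n) n≢y)
  ... | inj₁ j<n  =
    let (l , l<b , eq) = earlier j j<n j≢y in l , m≤n⇒m≤n⊔o (suc i) l<b , eq

-- A candidate other than `y` passes only if `y` has been read, which never happens. Once all the
-- others have been read, `y` itself passes, so the search succeeds.
missing-word : ∀ p n {y} → y < n → y ∉ range (p ∸1) →
  (∀ j → j < n → j ≢ y → j ∈ range (p ∸1)) → (missing n p ∸1) ≐ const y
missing-word p n {y} y<n y∉ others =
  eventually-constant (missing n p) y b zero-or-y after
  where
  seen : ℕ → ℕ → ℕ
  seen k j = search (λ i → difference (p i) (suc j)) k

  unseen-other : ℕ → ℕ → ℕ → ℕ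
  unseen-other k a j = ifZero (difference j a) 1 (seen k j)

  zero-or-y : ∀ k → missing n p k ≡ 0 ⊎ missing n p k ≡ suc y
  zero-or-y k with missing n p k in eq
  ... | zero  = inj₁ refl
  ... | suc a = inj₂ (cong suc a≡y)
    where
    y-seen : search (unseen-other k a) n ≡ 0 → y ≢ a → seen k y ≢ 0
    y-seen none y≢a unseen with difference y a in d | search-none (unseen-other k a) n none y y<n
    ... | zero  | _  = y≢a (difference≡0 y a d)
    ... | suc _ | nz = nz unseen

    a≡y : a ≡ y
    a≡y with y ≟ a
    ... | yes y≡a = sym y≡a
    ... | no y≢a with seen k y in s
                    | y-seen (proj₁ (proj₂ (search-some (λ a → search (unseen-other k a) n) n eq))) y≢a
    ...   | zero  | nz = contradiction refl nz
    ...   | suc i | _  = contradiction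
      (∈range p i (difference≡0 (p i) (suc y)
        (proj₁ (proj₂ (search-some (λ i → difference (p i) (suc y)) k s))))) y∉

  bound = enumeration-bound p y n λ j j<n j≢y → range∋ p (others j j<n j≢y)

  b : ℕ
  b = proj₁ bound

  others-seen : ∀ k → b ≤ k → search (unseen-other k y) n ≡ 0
  others-seen k b≤k with search (unseen-other k y) n in eq
  ... | zero  = refl
  -- A `j` reported as unseen differs from `y`, hence occurs at a position below `b`, which the
  -- inner search up to `k` cannot miss.
  ... | suc j with search-some (unseen-other k y) n eq
  ...   | j<n , uo , _ with difference j y in d
  ...     | suc _ =
    let j≢y = λ { refl → contradiction (trans (sym d) (difference-refl j)) λ () }
        (i , i<b , pi) = proj₂ bound j j<n j≢y
    in contradiction
         (trans (cong (λ x → difference x (suc j)) pi) (difference-refl (suc j)))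
         (search-none (λ i → difference (p i) (suc j)) k uo i (<-≤-trans i<b b≤k))

  after : ∀ k → b ≤ k → missing n p k ≡ suc y
  after k b≤k with zero-or-y k
  ... | inj₂ eq = eq
  ... | inj₁ eq = contradiction (others-seen k b≤k)
    (search-none (λ a → search (unseen-other k a) n) n eq y y<n)

-- Enumerating all numbers except the first letter

emit : ℕ → ℕ → ℕ → ℕ
emit n a j = ifZero (suc j ∸ n) (ifZero (difference j a) 0 (suc j)) 0

-- As a sequence, this is a name of the position of the first nonzero entry, or of ⊥ if there is
-- none.
firstNonzero : Baire → ℕ → ℕ
firstNonzero p = search (λ i → 1 ∸ p i)

-- If the first letter of p − 1 is read at position i, then at position i + 1 + j the number j
-- is enumerated, unless it is that letter or j ≥ n. An out-of-range letter is clamped, so that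
-- the result lies in the domain of AUC_n also then.
exclude : ℕ → Baire → ℕ → ℕ
exclude n p k = ifZero (firstNonzero p k) 0
  (emit n (clamp n (pred (p (pred (firstNonzero p k))))) (k ∸ firstNonzero p k))

firstNonzeroᵗ : Total 1
firstNonzeroᵗ = searchᵗ (num 1 ∸ᵗ ask (var zero)) (var zero)

excludeᵗ : ℕ → Total 1
excludeᵗ n = ifZeroᵗ firstNonzeroᵗ (num 0) (ifZeroᵗ (sucᵗ j ∸ᵗ num n)
  (ifZeroᵗ (differenceᵗ j (clampᵗ n (predᵗ (ask (predᵗ firstNonzeroᵗ))))) (num 0) (sucᵗ j))
  (num 0))
  where
  j = var zero ∸ᵗ firstNonzeroᵗ

emit-some : ∀ n a j {b} → emit n a j ≡ suc b → b < n × b ≢ a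
emit-some n a j eq with suc j ∸ n in le
... | zero with difference j a in d
emit-some n a j refl | zero | suc _ =
  m∸n≡0⇒m≤n le , λ { refl → contradiction (trans (sym d) (difference-refl j)) λ () }

emit-other : ∀ n a j → j < n → j ≢ a → emit n a j ≡ suc j
emit-other n a j j<n j≢a rewrite m≤n⇒m∸n≡0 j<n with difference j a in d
... | zero  = contradiction (difference≡0 j a d) j≢a
... | suc _ = refl

-- Entries are 0 until the first letter is found, and uniqueness of the least zero shows that the
-- number withheld afterwards comes from `a`.
exclude-range⊆ : ∀ n p {i a j} → FirstLetter p i a → j ∈ range (exclude n p ∸1) →
  j < n × j ≢ clamp n a
exclude-range⊆ n p {i} {a} first j∈ with range∋ (exclude n p) j∈
... | k , eq with firstNonzero p k in s
...   | suc i′ with leastZero-unique (λ i → 1 ∸ p i)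
                     (proj₂ (search-some (λ i → 1 ∸ p i) k s)) (firstLetter-least p first)
...     | refl rewrite proj₁ first = emit-some n (clamp n a) (k ∸ suc i) eq

exclude-range⊇ : ∀ n p {i a j} → FirstLetter p i a → j < n → j ≢ clamp n a →
  j ∈ range (exclude n p ∸1)
exclude-range⊇ n p {i} {a} {j} first j<n j≢ = ∈range (exclude n p) (suc i + j) eq
  where
  eq : exclude n p (suc i + j) ≡ suc j
  eq rewrite search-least (λ i → 1 ∸ p i) (firstLetter-least p first) (m≤m+n (suc i) j)
           | m+n∸m≡n i j | proj₁ first = emit-other n (clamp n a) j j<n j≢

exclude-zero : ∀ n p → p ≗ const 0 → Empty (range (exclude n p ∸1))
exclude-zero n p p≗0 j j∈ with range∋ (exclude n p) j∈
... | k , eq with firstNonzero p k in s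
...   | suc i = contradiction (trans (sym (cong (1 ∸_) (p≗0 i)))
          (proj₁ (proj₂ (search-some (λ i → 1 ∸ p i) k s)))) λ ()

-- The search at `l` inspects positions strictly below `l`, so `k` is found from `suc k` on.
firstNonzero-word : ∀ p {k a} → FirstLetter p k a → (firstNonzero p ∸1) ≐ const k
firstNonzero-word p {k} first = eventually-constant (firstNonzero p) k (suc k) cases
  (λ l k<l → search-least (λ i → 1 ∸ p i) (firstLetter-least p first) k<l)
  where
  cases : ∀ l → firstNonzero p l ≡ 0 ⊎ firstNonzero p l ≡ suc k
  cases l with firstNonzero p l in eq
  ... | zero  = inj₁ refl
  ... | suc i = inj₂ (cong suc (leastZero-unique (λ i → 1 ∸ p i)
    (proj₂ (search-some (λ i → 1 ∸ p i) l eq)) (firstLetter-least p first)))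

-- Reductions between retraction and choice problems

module Reductions (em : ExcludedMiddle 0ℓ) where
  open Classical em

  module _ {Y : Pred ℕ 0ℓ} where

    just∈dom : ∀ y → just y ∈ dom (retraction (subspace Y))
    just∈dom y = y , λ { _ (Maybe.just e) → sym e }

    -- By excluded middle `s` names an element of `Y` or ⊥. Since `0 ∈ Y`, ⊥ also lies in the domain
    -- of the retraction, so `G` answers in either case.
    retract : ∀ {G} → 0 ∈ Y → G realizes RET Y → ∀ s → ∃₂ λ q y → G ⟨ s ⟩↦ q × y ∈ Y × q 0 ≡ y ×
      (∀ w → (s ∸1) ≐ w → w 0 ∈ Y → w 0 ≡ y)
    retract 0∈Y rG s with em {∃ λ w → (s ∸1) ≐ w × w ∈ domain (δ (subspace Y))}
    ... | yes (w , s≐w , y , w0≡y) =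
      let (q , z , Gq , q0 , ret) = rG s (just y) (w , s≐w , w0≡y) (just∈dom y)
      in q , proj₁ z , Gq , proj₂ z , q0 , λ w′ s≐w′ _ →
           trans (∸1-functional s 0 (s≐w′ 0) (s≐w 0)) (trans w0≡y (ret y (Maybe.just refl)))
    ... | no ⊥-name =
      let (q , z , Gq , q0 , _) = rG s nothing ⊥-name ((0 , 0∈Y) , λ _ ())
      in q , proj₁ z , Gq , proj₂ z , q0 , λ w s≐w w0∈Y →
           contradiction (w , s≐w , (w 0 , w0∈Y) , refl) ⊥-name

  -- Treats `LLPO` and `AUC` together. If all numbers but `y` are enumerated, `missing n p` names
  -- `y`; if none below `n` is, any clamped answer is correct.
  choice-≤sW-RET : ∀ {n Y} → 0 < n → (∀ {y} → y < n → y ∈ Y) →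
    (f : 𝔹 ⇉ space (subspace (_< n))) →
    (∀ {p} y → graph f p y → graph (choice (_< n)) p y) →
    (∀ {p} y z → graph f p y → graph (choice (_< n)) p z → graph f p z) →
    (∀ {p} y → graph f p y → (∀ j → j < n → j ≢ proj₁ y → j ∈ range (p ∸1))
                           ⊎ (∀ j → j < n → j ∉ range (p ∸1))) →
    problem {baire} (_< n) f ≤sW RET Y
  choice-≤sW-RET {n} {Y} 0<n ⊆Y f ⊆choice ⊇choice alternatives =
    machine (code H) , machine (code K) , machine-computable _ , machine-computable _ ,
    λ G rG p x p≗x (y , fxy) →
      let fpy = resp f {b = y} {b′ = y} (sym ∘ p≗x) refl fxy
          (q , z , Gq , _ , q0≡z , names) = retract {Y} {G} (⊆Y 0<n) rG (missing n p)
          c = clamp n (q 0)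
          c<n = clamp-< (q 0) 0<n
          c∉ : c ∉ range (p ∸1)
          c∉ = case alternatives y fpy of λ
            { (inj₂ none) → none c c<n
            ; (inj₁ others) →
                let (y<n , y∉) = ⊆choice y fpy
                    q0≡y = trans q0≡z (sym (names (const (proj₁ y))
                             (missing-word p n y<n y∉ others) (⊆Y y<n)))
                    c≡y = trans (cong (clamp n) q0≡y) (clamp-fix y<n)
                in subst (_∉ range (p ∸1)) (sym c≡y) y∉ }
      in const c , (c , c<n) ,
         (q , (missing n p , computes K p , Gq) , computes H q) , refl ,
         resp f {b = c , c<n} {b′ = c , c<n} p≗x refl (⊇choice y (c , c<n) fpy (c<n , c∉))
    where
    H = clampᵗ n (ask (num 0))
    K = missingᵗ n

  -- Only one number below 2 differs from `y`: either it is enumerated, or nothing below 2 is.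
  LLPO-≤sW-RET : ∀ {n} → 2 ≤ n → LLPO ≤sW RET (_< n)
  LLPO-≤sW-RET 2≤n = choice-≤sW-RET (s≤s z≤n) (λ y<2 → <-≤-trans y<2 2≤n) (choice (_< 2))
    (λ _ v → v) (λ _ _ _ v → v) alternatives
    where
    agree : ∀ {j k y} → j < 2 → k < 2 → y < 2 → j ≢ y → k ≢ y → j ≡ k
    agree {0} {0} _ _ _ _ _ = refl
    agree {1} {1} _ _ _ _ _ = refl
    agree {0} {1} {0} _ _ _ j≢y _ = contradiction refl j≢y
    agree {0} {1} {1} _ _ _ _ k≢y = contradiction refl k≢y
    agree {1} {0} {0} _ _ _ _ k≢y = contradiction refl k≢y
    agree {1} {0} {1} _ _ _ j≢y _ = contradiction refl j≢y
    agree {suc (suc _)} (s≤s (s≤s ()))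
    agree {_} {suc (suc _)} _ (s≤s (s≤s ()))
    agree {_} {_} {suc (suc _)} _ _ (s≤s (s≤s ()))

    alternatives : ∀ {p} y → graph (choice (_< 2)) p y →
      (∀ j → j < 2 → j ≢ proj₁ y → j ∈ range (p ∸1)) ⊎ (∀ j → j < 2 → j ∉ range (p ∸1))
    alternatives {p} y (y<2 , y∉)
      with em {∃ λ k → k < 2 × k ≢ proj₁ y × k ∈ range (p ∸1)}
    ... | yes (k , k<2 , k≢y , k∈) = inj₁ λ j j<2 j≢y →
      subst (_∈ range (p ∸1)) (agree k<2 j<2 y<2 k≢y j≢y) k∈
    ... | no none = inj₂ λ j j<2 j∈ →
      none (j , j<2 , (λ j≡y → y∉ (subst (_∈ range (p ∸1)) j≡y j∈)) , j∈)

  AUC-≤sW-RET : ∀ {n} → 0 < n → AUC (_< n) ≤sW RET (_< n)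
  AUC-≤sW-RET {n} 0<n = choice-≤sW-RET 0<n id (allOrUnique (_< n))
    (λ _ → proj₂) (λ _ _ (p∈ , _) c → p∈ , c) alternatives
    where
    alternatives : ∀ {p} y → graph (allOrUnique (_< n)) p y →
      (∀ j → j < n → j ≢ proj₁ y → j ∈ range (p ∸1)) ⊎ (∀ j → j < n → j ∉ range (p ∸1))
    alternatives _ (inj₂ empty , _) = inj₂ λ j _ → empty j
    alternatives {p} _ (inj₁ (_ , _ , unique) , y∈) = inj₁ λ j j<n j≢y →
      case em {j ∈ range (p ∸1)} of λ
        { (yes j∈) → j∈
        ; (no j∉)  → contradiction (trans (sym (unique (j<n , j∉))) (unique y∈)) j≢y }

  -- A name of m < n also names m in the completion of `Y`, so `K` is the identity. A name of ⊥ may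
  -- lead to an answer outside n, hence the clamping in `H`.
  RET-≤sW-RET : ∀ {n Y} → 0 < n → (∀ {y} → y < n → y ∈ Y) → RET (_< n) ≤sW RET Y
  RET-≤sW-RET {n} {Y} 0<n ⊆Y =
    machine (code H) , machine (code K) , machine-computable _ , machine-computable _ ,
    λ G rG p x px _ →
      let (q , z , Gq , _ , q0≡z , names) = retract {Y} {G} (⊆Y 0<n) rG p
          c = clamp n (q 0)
      in const c , (c , clamp-< (q 0) 0<n) , (q , (p , computes K p , Gq) , computes H q) , refl ,
         correct x (q 0) (clamp-< (q 0) 0<n) px q0≡z names
    where
    H = clampᵗ n (ask (num 0))
    K = ask (var zero)
    correct : ∀ {p z} x q₀ (c<n : clamp n q₀ < n) →
      δ (completion (subspace (_< n))) ⟨ p ⟩↦ x → q₀ ≡ z →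
      (∀ w → (p ∸1) ≐ w → w 0 ∈ Y → w 0 ≡ z) →
      graph (retraction (subspace (_< n))) x (clamp n q₀ , c<n)
    correct nothing _ _ _ _ _ _ ()
    correct (just (m , m<n)) q₀ _ (w , p≐w , w0≡m) q₀≡z names _ (Maybe.just refl) =
      let q₀≡m = trans q₀≡z (trans (sym (names w p≐w (⊆Y (subst (_< n) (sym w0≡m) m<n)))) w0≡m)
      in sym (trans (cong (clamp n) q₀≡m) (clamp-fix m<n))

  firstLetter-or-zero : ∀ p → (∃₂ λ k a → FirstLetter p k a) ⊎ p ≗ const 0
  firstLetter-or-zero p with em {∃ λ k → p k ≢ 0}
  ... | no none = inj₂ λ k → decidable-stable (p k ≟ 0) λ pk≢0 → none (k , pk≢0)
  ... | yes (l , pl≢0) =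
    let (k , pk≢0 , k-least) = least (λ k → p k ≢ 0) l pl≢0
    in inj₁ (k , pred (p k) , sym (suc-pred (p k) {{≢-nonZero pk≢0}}) ,
         λ j j<k → decidable-stable (p j ≟ 0) λ pj≢0 → <⇒≱ j<k (k-least j pj≢0))

  -- Names of ⊥ must yield instances too: zero `p` enumerates nothing, and otherwise `clamp n a` is
  -- the one number left.
  exclude∈domain : ∀ n p → 0 < n → exclude n p ∈ allOrUniqueDomain (_< n)
  exclude∈domain n p 0<n with firstLetter-or-zero p
  ... | inj₂ p≗0             = inj₂ (exclude-zero n p p≗0)
  ... | inj₁ (k , a , first) = inj₁
    ( clamp n a , (clamp-< a 0<n , λ c∈ → proj₂ (exclude-range⊆ n p first c∈) refl)
    , λ {j} (j<n , j∉) → decidable-stable (clamp n a ≟ j) λ c≢j →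
        j∉ (exclude-range⊇ n p first j<n (≢-sym c≢j)) )

  domain⊆dom : ∀ {n p} → 0 < n → p ∈ allOrUniqueDomain (_< n) → p ∈ dom (allOrUnique (_< n))
  domain⊆dom 0<n p∈@(inj₁ (m , (m<n , m∉) , _)) = (m , m<n) , p∈ , m<n , m∉
  domain⊆dom 0<n p∈@(inj₂ empty)                = (0 , 0<n) , p∈ , 0<n , empty 0

  RET-≤sW-AUC : ∀ {n} → 0 < n → RET (_< n) ≤sW AUC (_< n)
  RET-≤sW-AUC {n} 0<n =
    machine (code H) , machine (code K) , machine-computable _ , machine-computable _ ,
    λ G rG p x px _ →
      let (q , y , Gq , q0≡y , _ , v) = rG (exclude n p) (exclude n p) (λ _ → refl)
                                           (domain⊆dom 0<n (exclude∈domain n p 0<n))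
      in q , y , (q , (exclude n p , computes K p , Gq) , computes H q) , q0≡y , correct x y px v
    where
    H = ask (var zero)
    K = excludeᵗ n
    correct : ∀ {p} x y → δ (completion (subspace (_< n))) ⟨ p ⟩↦ x →
      graph (choice (_< n)) (exclude n p) y → graph (retraction (subspace (_< n))) x y
    correct nothing _ _ _ _ ()
    correct {p} (just (m , m<n)) (y , _) (w , p≐w , w0≡m) (y<n , y∉) _ (Maybe.just refl) =
      -- A number below `n` other than the first letter `m` is enumerated, so it cannot be the
      -- answer.
      decidable-stable (m ≟ y) λ m≢y →
        let c≡m = trans (cong (clamp n) w0≡m) (clamp-fix m<n)
        in y∉ (exclude-range⊇ n p (proj₂ (firstLetter p (p≐w 0))) y<n
             (λ y≡c → m≢y (sym (trans y≡c c≡m))))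

  -- On the smaller domain the two problems have the same values, so both translations are the
  -- identity.
  AUC-≤sW-C : ∀ {n} → AUC (_< n) ≤sW C (_< n)
  AUC-≤sW-C {n} =
    machine (code I) , machine (code I) , machine-computable _ , machine-computable _ ,
    λ G rG p x p≗x (y , x∈ , v) →
      let (q , z , Gq , q0≡z , c) = rG p x p≗x (y , v)
      in q , z , (q , (p , computes I p , Gq) , computes I q) , q0≡z , x∈ , c
    where
    I = ask (var zero)

  -- Retraction on the natural numbers and `LPO`

  LPO-≤W-RET : LPO ≤W RET U
  LPO-≤W-RET =
    machine (code H) , machine (code K) , machine-computable _ , machine-computable _ ,
    λ G rG p x p≗x _ →
      let (q , z , Gq , _ , q0≡z , names) = retract {U} {G} _ rG (firstNonzero p)
          r = ⟨ p , q ⟩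
          -- `r 1` is the returned number `q 0`, and `r` holds `p (q 0)` at the even position
          -- `r 1 + r 1`.
          v = 1 ∸ r (r 1 + r 1)
      in const v , (v , s≤s (m∸n≤m 1 (r (r 1 + r 1)))) ,
         (r , (q , (firstNonzero p , computes K p , Gq) , λ _ → refl) , computes H r) , refl ,
         subst (λ a → 1 ∸ a ≡ 1 ⇔ x ≗ const 0) (sym (⟨,⟩-even p q (q 0)))
           (correct p≗x λ w s≐w → trans q0≡z (sym (names w s≐w _)))
    where
    H = num 1 ∸ᵗ ask (ask (num 1) +ᵗ ask (num 1))
    K = firstNonzeroᵗ
    correct : ∀ {p x i} → p ≗ x → (∀ w → (firstNonzero p ∸1) ≐ w → i ≡ w 0) →
      1 ∸ p i ≡ 1 ⇔ x ≗ const 0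
    correct {p} p≗x position with firstLetter-or-zero p
    ... | inj₂ p≗0 = mk⇔ (λ _ k → trans (sym (p≗x k)) (p≗0 k)) (λ _ → cong (1 ∸_) (p≗0 _))
    ... | inj₁ (k , a , first) with refl ← position (const k) (firstNonzero-word p first) = mk⇔
      (λ eq → contradiction (trans (sym (proj₁ (firstLetter-least p first))) eq) λ ())
      (λ x≗0 → contradiction (trans (sym (proj₁ first)) (trans (p≗x k) (x≗0 k))) λ ())

  isZero-total : ∀ p → p ∈ dom isZero
  isZero-total p with firstLetter-or-zero p
  ... | inj₂ p≗0 = (1 , s≤s (s≤s z≤n)) , mk⇔ (λ _ → p≗0) (λ _ → refl)
  ... | inj₁ (k , _ , pk , _) = (0 , s≤s z≤n) ,
    mk⇔ (λ ()) (λ p≗0 → contradiction (trans (sym pk) (p≗0 k)) λ ())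

  RET-≤W-LPO : RET U ≤W LPO
  RET-≤W-LPO =
    machine H , machine (code K) , machine-computable H , machine-computable _ ,
    λ G rG p x px _ →
      let (q , y , Gq , q0≡y , zero?) = rG p p (λ _ → refl) (isZero-total p)
          (i , l , ret) = correct p q x px
            (subst (λ z → z < 2 × (z ≡ 1 ⇔ p ≗ const 0)) (sym q0≡y) (proj₂ y , zero?))
          -- This is the letter read at `p i`, or the default 0 if `p` is zero.
          v = pred (⟨ p , q ⟩ (i + i))
      in const v , (v , _) ,
         (⟨ p , q ⟩ , (q , (p , computes K p , Gq) , λ _ → refl) ,
           λ n → comp (i ∷ []) (λ { zero → minimise search-letter l }) (sound letter-at _ (i ∷ []))) ,
         refl , ret
    where
    letter-at : Total 1
    letter-at = predᵗ (ask (var zero +ᵗ var zero))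
    -- With oracle ⟨ p , q ⟩, holds at i if p i ≢ 0 or q 0 ≢ 0; the second alternative makes
    -- the search terminate also if p is zero.
    search-letter : Total 2
    search-letter = num 1 ∸ᵗ (ask (var zero +ᵗ var zero) +ᵗ ask (num 1))
    -- An unbounded search need not halt, so `H` is a bare code and not a `Total`; halting is shown
    -- for the oracles that occur.
    H = comp (code letter-at) (min (code search-letter) ∷ [])
    K = ask (var zero)

    correct : ∀ p q x → δ (completion (subspace U)) ⟨ p ⟩↦ x →
      q 0 < 2 × (q 0 ≡ 1 ⇔ p ≗ const 0) →
      ∃ λ i → LeastZero (λ i → 1 ∸ (⟨ p , q ⟩ (i + i) + q 0)) i ×
              graph (retraction (subspace U)) x (pred (⟨ p , q ⟩ (i + i)) , _)
    correct p q x px (q0<2 , zero?) with firstLetter-or-zero p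
    -- Here `q 0` is 1, which stops the search at 0; zero `p` names ⊥, for which any answer is
    -- correct.
    ... | inj₂ p≗0 = 0 , (first-position , λ _ ()) , no-word x px
      where
      first-position : 1 ∸ (p 0 + q 0) ≡ 0
      first-position = cong₂ (λ a b → 1 ∸ (a + b)) (p≗0 0) (Equivalence.from zero? p≗0)
      no-word : ∀ x → δ (completion (subspace U)) ⟨ p ⟩↦ x →
        graph (retraction (subspace U)) x (pred (p 0) , _)
      no-word nothing  _             _ ()
      no-word (just _) (_ , p≐w , _) with firstLetter p (p≐w 0)
      ... | k , pk , _ = contradiction (trans (sym pk) (p≗0 k)) λ ()
    -- Here `q 0` is 0, so the search is decided by `p` alone and stops at its first letter.
    ... | inj₁ (k , a , first@(pk , below)) =
      k , (here , before) , letter-is x px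
      where
      q0≡0 : q 0 ≡ 0
      q0≡0 = n<1⇒n≡0 (≤∧≢⇒< (≤-pred q0<2) λ q0≡1 →
        contradiction (trans (sym pk) (Equivalence.to zero? q0≡1 k)) λ ())
      here : 1 ∸ (⟨ p , q ⟩ (k + k) + q 0) ≡ 0
      here rewrite ⟨,⟩-even p q k | pk = 0∸n≡0 (a + q 0)
      before : ∀ j → j < k → 1 ∸ (⟨ p , q ⟩ (j + j) + q 0) ≢ 0
      before j j<k rewrite ⟨,⟩-even p q j | below j j<k | q0≡0 = λ ()
      letter-is : ∀ x → δ (completion (subspace U)) ⟨ p ⟩↦ x →
        graph (retraction (subspace U)) x (pred (⟨ p , q ⟩ (k + k)) , _)
      letter-is nothing _ _ ()
      letter-is (just _) (w , p≐w , w0≡m) _ (Maybe.just refl) = trans (sym w0≡m)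
        (trans (firstLetter-unique p (p≐w 0) first) (sym (cong pred (trans (⟨,⟩-even p q k) pk))))

proposition7p8 : (em : ExcludedMiddle 0ℓ) → let open Classical em in
    ∀ (n : ℕ) → 2 ≤ n →
    (LLPO ≤sW RET (_< n) × RET (_< n) ≡sW AUC (_< n) × AUC (_< n) ≤sW C (_< n))
    × (RET (_< n) ≤sW RET U × RET U ≡W LPO)
proposition7p8 em n 2≤n =
  (LLPO-≤sW-RET 2≤n , (RET-≤sW-AUC 0<n , AUC-≤sW-RET 0<n) , AUC-≤sW-C)
  , (RET-≤sW-RET 0<n (λ _ → _) , (RET-≤W-LPO , LPO-≤W-RET))
  where
  open Reductions em
  0<n : 0 < n
  0<n = <-≤-trans (s≤s z≤n) 2≤n
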